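{- For every finite connected graph $G$, $\mathcal{L}^m(G)\le 2\operatorname{pw}(G)+2$.
   Context: Lions and contamination game. Let $G=(V,E)$ be a finite graph, $N(v)$ the set of neighbours of $v$. A lion strategy with $k\ge 1$ lions consists of initial positions $p_1(0),\dots,p_k(0)\in V$ and, for each $t\ge 1$, positions $p_i(t)\in\{p_i(t-1)\}\cup N(p_i(t-1))$. Put $L_t=\{p_i(t)\}_i$, $\pi_t=\{(p_i(t-1),p_i(t))\}_i$. Contaminated sets: $W_0=V\setminus L_0$, and for $t\ge1$, $W_t=(W_{t-1}\setminus L_t)\cup\{v\in V\setminus L_t:\exists w\in W_{t-1}\cap N(v)\text{ with }(v,w)\notin\pi_t,(w,v)\notin\pi_t\}$. The strategy clears $G$ if $W_T=\emptyset$ for some $T$. It is monotone if $W_t\subseteq W_{t-1}$ for all $t\ge1$. The monotone lion number $\mathcal{L}^m(G)$ is the minimum number of lions of a monotone strategy clearing $G$. $\operatorname{pw}(G)$ denotes the pathwidth of $G$. -}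

module Defs where

open import Data.Nat using (ℕ; zero; suc; _≤_; _<_; _+_; _*_)
open import Data.Fin using (Fin) renaming (_≤_ to _≤ᶠ_)
open import Data.Fin.Subset using (Subset; _∈_; ∣_∣)
open import Data.Bool using (Bool; true; false)
open import Data.Product using (Σ; ∃; ∃-syntax; _×_; _,_)
open import Data.Sum using (_⊎_)
open import Relation.Binary.PropositionalEquality using (_≡_)
open import Relation.Nullary using (¬_)

record Graph : Set where
  field
    n     : ℕ
    adj   : Fin n → Fin n → Bool
    sym   : ∀ u v → adj u v ≡ adj v u
    irrefl : ∀ v → adj v v ≡ false

open Graph public

Adj : (G : Graph) → Fin (n G) → Fin (n G) → Set
Adj G u v = adj G u v ≡ true

data Walk (G : Graph) : Fin (n G) → Fin (n G) → Set where
  here : ∀ {v} → Walk G v v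
  step : ∀ {u w v} → Adj G u w → Walk G w v → Walk G u v

Connected : Graph → Set
Connected G = (0 < n G) × (∀ u v → Walk G u v)

record PathDecomposition (G : Graph) : Set where
  field
    len  : ℕ
    bag  : Fin len → Subset (n G)
    covers-vertices : ∀ v → ∃[ i ] (v ∈ bag i)
    covers-edges    : ∀ u v → Adj G u v → ∃[ i ] (u ∈ bag i × v ∈ bag i)
    interpolation   : ∀ (v : Fin (n G)) (i j k : Fin len) →
                      i ≤ᶠ j → j ≤ᶠ k → v ∈ bag i → v ∈ bag k → v ∈ bag j

open PathDecomposition public

HasWidth≤ : {G : Graph} → PathDecomposition G → ℕ → Set
HasWidth≤ D w = ∀ i → ∣ bag D i ∣ ≤ suc w

Pathwidth : Graph → ℕ → Set
Pathwidth G w =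
  (Σ (PathDecomposition G) λ D → HasWidth≤ D w) ×
  (∀ w' → (D : PathDecomposition G) → HasWidth≤ D w' → w ≤ w')

record LionStrategy (G : Graph) (k : ℕ) : Set where
  field
    pos   : ℕ → Fin k → Fin (n G)
    moves : ∀ t i → pos (suc t) i ≡ pos t i ⊎ Adj G (pos t i) (pos (suc t) i)

open LionStrategy public

module _ {G : Graph} {k : ℕ} (S : LionStrategy G k) where

  InL : ℕ → Fin (n G) → Set
  InL t v = ∃[ i ] (pos S t i ≡ v)

  InΠ : ℕ → Fin (n G) → Fin (n G) → Set
  InΠ t v w = ∃[ i ] (pos S t i ≡ v × pos S (suc t) i ≡ w)

  W : ℕ → Fin (n G) → Set
  W zero v = ¬ InL zero v
  W (suc t) v =
    ¬ InL (suc t) v ×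
    (W t v ⊎ ∃[ w ] (W t w × Adj G v w × ¬ InΠ t v w × ¬ InΠ t w v))

  Clears : Set
  Clears = ∃[ T ] (∀ v → ¬ W T v)

  Monotone : Set
  Monotone = ∀ t v → W (suc t) v → W t v

MonotoneClearable : Graph → ℕ → Set
MonotoneClearable G k =
  Σ (LionStrategy G k) λ S → Monotone S × Clears S

{-# OPTIONS --safe #-}
module Submission where

-- Let X be a path decomposition of width w.  For a vertex set C and a level m,
-- let left C m (right C m) count the u ∈ C joined to some v ∉ C by an edge lying
-- in a bag X i with i ≤ m (i ≥ m).  Call C balanced if, for every m, left C m or
-- right C m is at most ∣C ∩ X m∣.  A balanced set has at most 2w vertices with
-- neighbours outside, and a nonempty balanced C ≠ V remains balanced on adding a
-- suitable adjacent vertex.  So G is exhausted by connected balanced sets grown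
-- one vertex at a time, and 2w + 1 lions, all starting at one vertex, can follow:
-- some lion is not needed to guard the boundary of C, and it walks inside C to
-- the next vertex.

open import Defs hiding (sym)
open import Data.Nat using (ℕ; _≤_; _+_; _*_)
open import Data.Product using (∃-syntax; _×_)

open import Data.Bool using (true; false)
import Data.Bool as Bool
open import Data.Empty using (⊥-elim)
open import Data.Fin using (Fin; zero; suc; toℕ; fromℕ<) renaming (_≤_ to _≤ᶠ_; _<_ to _<ᶠ_)
import Data.Fin.Properties as Fin
open import Data.Fin.Subset using (Subset; _∈_; _∉_; _⊆_; _∪_; _∩_; ⁅_⁆; ⊥; ⊤; ∣_∣)
open import Data.Fin.Subset.Properties using (_∈?_; p⊆q⇒∣p∣≤∣q∣; p⊂q⇒∣p∣<∣q∣; ∣p∣≤n; ∣⊤∣≡n; ∣⊥∣≡0; ∣⁅x⁆∣≡1; ∉⊥; x∈⁅x⁆; x∈⁅y⁆⇒x≡y; x∈p∪q⁻; x∈p∪q⁺; x∈p∩q⁻; x∈p∩q⁺; p∩q⊆q)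
open import Data.Nat using (zero; suc; _<_; _<?_; _≤?_; z≤n; s≤s)
import Data.Nat.Properties as ℕ
open import Data.Product using (∃; Σ; _,_; proj₁; proj₂)
open import Data.Sum using (_⊎_; inj₁; inj₂; [_,_]′)
open import Data.Vec using ([]; _∷_; tabulate; here; there)
open import Data.Vec.Functional using (updateAt)
open import Data.Vec.Functional.Properties using (updateAt-updates; updateAt-minimal)
open import Data.Vec.Properties using (lookup∘tabulate; []=⇒lookup; lookup⇒[]=)
open import Function using (_∘_; const; id; flip)
open import Level using (0ℓ)
open import Relation.Binary.Construct.Closure.ReflexiveTransitive using (Star; ε; _◅_; _◅◅_)
open import Relation.Binary.Definitions using (tri<; tri≈; tri>)
open import Relation.Binary.PropositionalEquality using (_≡_; _≢_; refl; sym; trans; cong; subst)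
open import Relation.Nullary using (¬_; Dec; yes; no; does; contradiction; ¬?; _×-dec_)
open import Relation.Nullary.Decidable using (dec-true; decidable-stable)
open import Relation.Unary using (Pred; Decidable)

private
  variable
    N : ℕ

-- Finite subsets

comprehension : {P : Pred (Fin N) 0ℓ} → Decidable P → Subset N
comprehension P? = tabulate (does ∘ P?)

∈-comprehension⁺ : {P : Pred (Fin N) 0ℓ} (P? : Decidable P) {x : Fin N} → P x → x ∈ comprehension P?
∈-comprehension⁺ P? {x} px =
  lookup⇒[]= x _ (trans (lookup∘tabulate (does ∘ P?) x) (dec-true (P? x) px))

∈-comprehension⁻ : {P : Pred (Fin N) 0ℓ} (P? : Decidable P) {x : Fin N} → x ∈ comprehension P? → P x
∈-comprehension⁻ P? {x} x∈ with P? x | trans (sym (lookup∘tabulate (does ∘ P?) x)) ([]=⇒lookup x∈)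
... | yes px | _  = px
... | no  _  | ()

∣p∪q∣≤∣p∣+∣q∣ : (p q : Subset N) → ∣ p ∪ q ∣ ≤ ∣ p ∣ + ∣ q ∣
∣p∪q∣≤∣p∣+∣q∣ []          []          = z≤n
∣p∪q∣≤∣p∣+∣q∣ (false ∷ p) (false ∷ q) = ∣p∪q∣≤∣p∣+∣q∣ p q
∣p∪q∣≤∣p∣+∣q∣ (false ∷ p) (true  ∷ q) =
  ℕ.≤-trans (s≤s (∣p∪q∣≤∣p∣+∣q∣ p q)) (ℕ.≤-reflexive (sym (ℕ.+-suc ∣ p ∣ ∣ q ∣)))
∣p∪q∣≤∣p∣+∣q∣ (true  ∷ p) (false ∷ q) = s≤s (∣p∪q∣≤∣p∣+∣q∣ p q)
∣p∪q∣≤∣p∣+∣q∣ (true  ∷ p) (true  ∷ q) =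
  s≤s (ℕ.≤-trans (∣p∪q∣≤∣p∣+∣q∣ p q) (ℕ.+-monoʳ-≤ ∣ p ∣ (ℕ.n≤1+n ∣ q ∣)))

∣p∪⁅x⁆∣≤1+∣p∣ : (p : Subset N) (x : Fin N) → ∣ p ∪ ⁅ x ⁆ ∣ ≤ suc ∣ p ∣
∣p∪⁅x⁆∣≤1+∣p∣ p x = ℕ.≤-trans (∣p∪q∣≤∣p∣+∣q∣ p ⁅ x ⁆)
  (ℕ.≤-reflexive (trans (cong (∣ p ∣ +_) (∣⁅x⁆∣≡1 x)) (ℕ.+-comm ∣ p ∣ 1)))

x∈p∪⁅y⁆⁻ : (p : Subset N) (y : Fin N) {x : Fin N} → x ∈ p ∪ ⁅ y ⁆ → x ∈ p ⊎ x ≡ y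
x∈p∪⁅y⁆⁻ p y x∈ with x∈p∪q⁻ p ⁅ y ⁆ x∈
... | inj₁ x∈p = inj₁ x∈p
... | inj₂ x∈y = inj₂ (x∈⁅y⁆⇒x≡y y x∈y)

p⊆p∪⁅x⁆ : (p : Subset N) (x : Fin N) → p ⊆ p ∪ ⁅ x ⁆
p⊆p∪⁅x⁆ p x x∈p = x∈p∪q⁺ (inj₁ x∈p)

x∈p∪⁅x⁆ : (p : Subset N) (x : Fin N) → x ∈ p ∪ ⁅ x ⁆
x∈p∪⁅x⁆ p x = x∈p∪q⁺ {p = p} (inj₂ (x∈⁅x⁆ x))

x∉p⇒∣p∣<∣p∪⁅x⁆∣ : (p : Subset N) {x : Fin N} → x ∉ p → ∣ p ∣ < ∣ p ∪ ⁅ x ⁆ ∣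
x∉p⇒∣p∣<∣p∪⁅x⁆∣ p {x} x∉p = p⊂q⇒∣p∣<∣q∣ (p⊆p∪⁅x⁆ p x , x , x∈p∪⁅x⁆ p x , x∉p)

empty⇒∣p∣≡0 : (p : Subset N) → (∀ x → x ∉ p) → ∣ p ∣ ≡ 0
empty⇒∣p∣≡0 {N} p empty = ℕ.n≤0⇒n≡0
  (subst (∣ p ∣ ≤_) (∣⊥∣≡0 N) (p⊆q⇒∣p∣≤∣q∣ {q = ⊥} (λ x∈p → ⊥-elim (empty _ x∈p))))

least : {P : Pred (Fin N) 0ℓ} → Decidable P → (∀ i → ¬ P i) ⊎ ∃[ i ] (P i × ∀ j → P j → i ≤ᶠ j)
least {zero}  P? = inj₁ λ ()
least {suc N} P? with P? zero | least (P? ∘ suc)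
... | yes p₀ | _ = inj₂ (zero , p₀ , λ _ _ → z≤n)
... | no ¬p₀ | inj₁ none = inj₁ λ { zero → ¬p₀ ; (suc i) → none i }
... | no ¬p₀ | inj₂ (i , pi , i≤) =
  inj₂ (suc i , pi , λ { zero p₀ → contradiction p₀ ¬p₀ ; (suc j) pj → s≤s (i≤ j pj) })

greatest : {P : Pred (Fin N) 0ℓ} → Decidable P → (∀ i → ¬ P i) ⊎ ∃[ i ] (P i × ∀ j → P j → j ≤ᶠ i)
greatest {zero}  P? = inj₁ λ ()
greatest {suc N} P? with greatest (P? ∘ suc) | P? zero
... | inj₂ (i , pi , ≤i) | _ = inj₂ (suc i , pi , λ { zero _ → z≤n ; (suc j) pj → s≤s (≤i j pj) })
... | inj₁ none | yes p₀ = inj₂ (zero , p₀ , λ { zero _ → z≤n ; (suc j) pj → contradiction pj (none j) })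
... | inj₁ none | no ¬p₀ = inj₁ λ { zero → ¬p₀ ; (suc i) → none i }

-- One index is chosen for each element of `S`, and coinciding choices only make `T` smaller. An
-- arbitrary relation `R` is used because the recursion along `S` shifts the vertex argument by
-- `suc`, a shift under which the form `p j ≡ u` is not stable.
transversal : {k : ℕ} (R : Fin k → Fin N → Set) (S : Subset N) → (∀ {u} → u ∈ S → ∃[ j ] R j u) →
  Σ (Subset k) λ T → ∣ T ∣ ≤ ∣ S ∣ × (∀ {u} → u ∈ S → ∃[ j ] (j ∈ T × R j u))
transversal {k = k} R [] choose = ⊥ , ℕ.≤-reflexive (∣⊥∣≡0 k) , λ ()
transversal R (false ∷ S) choose with transversal (λ j u → R j (suc u)) S (choose ∘ there)
... | T , T≤S , covers = T , T≤S , λ { (there u∈S) → covers u∈S }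
transversal R (true ∷ S) choose with transversal (λ j u → R j (suc u)) S (choose ∘ there) | choose here
... | T , T≤S , covers | j , Rj0 =
  T ∪ ⁅ j ⁆ , ℕ.≤-trans (∣p∪⁅x⁆∣≤1+∣p∣ T j) (s≤s T≤S) , covers′
  where
  covers′ : ∀ {u} → u ∈ true ∷ S → ∃[ i ] (i ∈ T ∪ ⁅ j ⁆ × R i u)
  covers′ here = j , x∈p∪⁅x⁆ T j , Rj0
  covers′ (there u∈S) with covers u∈S
  ... | i , i∈T , Riu = i , p⊆p∪⁅x⁆ T j i∈T , Riu

-- A transversal of `S` has at most `∣ S ∣ < k` indices, so some index `i` lies outside it, and the
-- transversal alone still covers `S`.
spare : {k : ℕ} (p : Fin k → Fin N) (S : Subset N) → (∀ {u} → u ∈ S → ∃[ j ] p j ≡ u) → ∣ S ∣ < k →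
  ∃[ i ] (∀ {u} → u ∈ S → ∃[ j ] (j ≢ i × p j ≡ u))
spare {k = k} p S onto S<k with transversal (λ j u → p j ≡ u) S onto
... | T , T≤S , covers with Fin.¬∀⟶∃¬ k (_∈ T) (_∈? T) T≢⊤
  where
  T≢⊤ : ¬ (∀ i → i ∈ T)
  T≢⊤ all = ℕ.<⇒≱ (ℕ.≤-<-trans T≤S S<k)
    (subst (_≤ ∣ T ∣) (∣⊤∣≡n k) (p⊆q⇒∣p∣≤∣q∣ {p = ⊤} {q = T} (λ {x} _ → all x)))
... | i , i∉T = i , λ u∈S → let j , j∈T , pj≡u = covers u∈S in
  j , (λ j≡i → i∉T (subst (_∈ T) j≡i j∈T)) , pj≡u

-- Balanced sets

module Balance (G : Graph) (D : PathDecomposition G) where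

  private
    V Level : Set
    V     = Fin (n G)
    Level = Fin (len D)

    X : Level → Subset (n G)
    X = bag D

  -- With the level predicate left open, `left`, `right`, `∂` and the prefixes of the later sweep
  -- are instances of one construction.
  IsFront : Pred Level 0ℓ → Subset (n G) → Pred V 0ℓ
  IsFront P C u =
    u ∈ C × ∃[ v ] (v ∉ C × Adj G u v × ∃[ i ] (P i × u ∈ X i × v ∈ X i))

  isFront? : {P : Pred Level 0ℓ} → Decidable P → ∀ C → Decidable (IsFront P C)
  isFront? P? C u = u ∈? C ×-dec Fin.any? λ v →
    ¬? (v ∈? C) ×-dec (adj G u v Bool.≟ true) ×-dec Fin.any? λ i →
    P? i ×-dec u ∈? X i ×-dec v ∈? X i

  front : {P : Pred Level 0ℓ} → Decidable P → Subset (n G) → Subset (n G)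
  front P? C = comprehension (isFront? P? C)

  -- The implication between `P` and `Q` may use the whole edge leaving `C` and not only its level:
  -- some of the comparisons below hold only at levels that carry such an edge.
  front-mono : {P Q : Pred Level 0ℓ} (P? : Decidable P) (Q? : Decidable Q) {C : Subset (n G)} →
    (∀ {u v} i → v ∉ C → Adj G u v → u ∈ C → u ∈ X i → v ∈ X i → P i → Q i) →
    ∣ front P? C ∣ ≤ ∣ front Q? C ∣
  front-mono P? Q? {C} P⇒Q = p⊆q⇒∣p∣≤∣q∣ λ u∈ →
    let u∈C , v , v∉C , uv , i , Pi , u∈i , v∈i = ∈-comprehension⁻ (isFront? P? C) u∈ in
    ∈-comprehension⁺ (isFront? Q? C) (u∈C , v , v∉C , uv , i , P⇒Q i v∉C uv u∈C u∈i v∈i Pi , u∈i , v∈i)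

  front-empty : {P : Pred Level 0ℓ} (P? : Decidable P) {C : Subset (n G)} →
    (∀ {u v} i → v ∉ C → Adj G u v → u ∈ C → u ∈ X i → v ∈ X i → ¬ P i) → ∣ front P? C ∣ ≡ 0
  front-empty P? {C} none = empty⇒∣p∣≡0 _ λ u u∈ →
    let u∈C , v , v∉C , uv , i , Pi , u∈i , v∈i = ∈-comprehension⁻ (isFront? P? C) u∈ in
    none i v∉C uv u∈C u∈i v∈i Pi

  -- A neighbour outside the larger set is also outside `C`, so `v` is the only possible new front
  -- vertex.
  front-∪⁅⁆ : {P : Pred Level 0ℓ} (P? : Decidable P) (C : Subset (n G)) (v : V) →
    ∣ front P? (C ∪ ⁅ v ⁆) ∣ ≤ suc ∣ front P? C ∣
  front-∪⁅⁆ P? C v = ℕ.≤-trans (p⊆q⇒∣p∣≤∣q∣ incl) (∣p∪⁅x⁆∣≤1+∣p∣ (front P? C) v)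
    where
    incl : front P? (C ∪ ⁅ v ⁆) ⊆ front P? C ∪ ⁅ v ⁆
    incl u∈ with ∈-comprehension⁻ (isFront? P? (C ∪ ⁅ v ⁆)) u∈
    ... | u∈Cv , x , x∉Cv , ux , rest with x∈p∪⁅y⁆⁻ C v u∈Cv
    ...   | inj₁ u∈C  = p⊆p∪⁅x⁆ _ v (∈-comprehension⁺ (isFront? P? C) (u∈C , x , x∉Cv ∘ p⊆p∪⁅x⁆ C v , ux , rest))
    ...   | inj₂ refl = x∈p∪⁅x⁆ (front P? C) v

  front-∪⁅⁆-avoiding : {P : Pred Level 0ℓ} (P? : Decidable P) (C : Subset (n G)) (v : V) →
    (∀ i → v ∈ X i → ¬ P i) → ∣ front P? (C ∪ ⁅ v ⁆) ∣ ≤ ∣ front P? C ∣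
  front-∪⁅⁆-avoiding P? C v avoids = p⊆q⇒∣p∣≤∣q∣ incl
    where
    incl : front P? (C ∪ ⁅ v ⁆) ⊆ front P? C
    incl u∈ with ∈-comprehension⁻ (isFront? P? (C ∪ ⁅ v ⁆)) u∈
    ... | u∈Cv , x , x∉Cv , ux , i , Pi , u∈i , x∈i with x∈p∪⁅y⁆⁻ C v u∈Cv
    ...   | inj₁ u∈C  = ∈-comprehension⁺ (isFront? P? C) (u∈C , x , x∉Cv ∘ p⊆p∪⁅x⁆ C v , ux , i , Pi , u∈i , x∈i)
    ...   | inj₂ refl = contradiction Pi (avoids i u∈i)

  left right : Subset (n G) → Level → ℕ
  left  C m = ∣ front (Fin._≤? m) C ∣
  right C m = ∣ front (m Fin.≤?_) C ∣

  inner : Subset (n G) → Level → ℕ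
  inner C m = ∣ C ∩ X m ∣

  Balanced : Subset (n G) → Set
  Balanced C = ∀ m → left C m ≤ inner C m ⊎ right C m ≤ inner C m

  -- A predicate true at every level. Since each edge lies in some bag, `∂ C` is the full set of
  -- vertices of `C` with a neighbour outside `C`.
  always : Decidable {A = Level} (λ i → i ≡ i)
  always i = yes refl

  ∂ : Subset (n G) → Subset (n G)
  ∂ = front always

  ∈∂⁺ : ∀ {C u v} → u ∈ C → v ∉ C → Adj G u v → u ∈ ∂ C
  ∈∂⁺ {C} {u} {v} u∈C v∉C uv with covers-edges D u v uv
  ... | i , u∈i , v∈i = ∈-comprehension⁺ (isFront? always C) (u∈C , v , v∉C , uv , i , refl , u∈i , v∈i)

  -- A level whose bag meets the complement of C has inner C m ≤ w, and only
  -- such levels carry edges leaving C.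
  balanced⇒∣∂∣≤2w : ∀ {w C} → HasWidth≤ D w → Balanced C → ∣ ∂ C ∣ ≤ w + w
  balanced⇒∣∂∣≤2w {w} {C} width bal with sweep (len D) ℕ.≤-refl
    where
    before? : ∀ l → Decidable (λ (i : Level) → toℕ i < l)
    before? l i = toℕ i <? l

    -- The levels are swept in increasing order. Until the bound on `∂ C` is established, the
    -- invariant is that the levels below `l` contribute at most `w` front vertices.
    sweep : ∀ l → l ≤ len D → ∣ ∂ C ∣ ≤ w + w ⊎ ∣ front (before? l) C ∣ ≤ w
    sweep zero _ = inj₂ (ℕ.≤-trans (ℕ.≤-reflexive (front-empty (before? 0) λ _ _ _ _ _ _ ())) z≤n)
    sweep (suc l) l<len with sweep l (ℕ.<⇒≤ l<len)
    ... | inj₁ done = inj₁ done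
    ... | inj₂ before≤w = extend (Fin.any? λ v → v ∈? X m ×-dec ¬? (v ∈? C))
      where
      m : Level
      m = fromℕ< l<len

      m≡l : toℕ m ≡ l
      m≡l = Fin.toℕ-fromℕ< l<len

      inner≤w : ∀ {v} → v ∈ X m → v ∉ C → inner C m ≤ w
      inner≤w {v} v∈m v∉C = ℕ.≤-pred (ℕ.<-≤-trans
        (p⊂q⇒∣p∣<∣q∣ (p∩q⊆q C (X m) , v , v∈m , v∉C ∘ proj₁ ∘ x∈p∩q⁻ C (X m))) (width m))

      extend : Dec (∃[ v ] (v ∈ X m × v ∉ C)) → ∣ ∂ C ∣ ≤ w + w ⊎ ∣ front (before? (suc l)) C ∣ ≤ w
      -- Here `X m` is contained in `C`, so it carries no edge leaving `C` and the front does not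
      -- change.
      extend (no closed) = inj₂ (ℕ.≤-trans (front-mono (before? (suc l)) (before? l) λ {u} {v} i v∉C _ _ _ v∈i i<1+l →
        ℕ.≤∧≢⇒< (ℕ.≤-pred i<1+l)
          λ i≡l → closed (v , subst (λ j → v ∈ X j) (Fin.toℕ-injective (trans i≡l (sym m≡l))) v∈i , v∉C)) before≤w)
      extend (yes (v , v∈m , v∉C)) with bal m
      -- `left C m` already counts every level up to `m`, so it replaces the earlier bound instead
      -- of being added to it.
      ... | inj₁ left≤ = inj₂ (ℕ.≤-trans
              (front-mono (before? (suc l)) (Fin._≤? m) λ i _ _ _ _ _ i<1+l → subst (toℕ i ≤_) (sym m≡l) (ℕ.≤-pred i<1+l))
              (ℕ.≤-trans left≤ (inner≤w v∈m v∉C)))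
      -- The sweep ends: levels below `m` contribute at most `w`, and those from `m` on at most
      -- `right C m`, which is also at most `w`.
      ... | inj₂ right≤ = inj₁ (ℕ.≤-trans (p⊆q⇒∣p∣≤∣q∣ incl)
              (ℕ.≤-trans (∣p∪q∣≤∣p∣+∣q∣ (front (before? l) C) (front (m Fin.≤?_) C))
                (ℕ.+-mono-≤ before≤w (ℕ.≤-trans right≤ (inner≤w v∈m v∉C)))))
        where
        incl : ∂ C ⊆ front (before? l) C ∪ front (m Fin.≤?_) C
        incl u∈ with ∈-comprehension⁻ (isFront? always C) u∈
        ... | u∈C , x , x∉C , ux , i , _ , u∈i , x∈i with toℕ i <? l
        ...   | yes i<l = x∈p∪q⁺ (inj₁ (∈-comprehension⁺ (isFront? (before? l) C)
                            (u∈C , x , x∉C , ux , i , i<l , u∈i , x∈i)))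
        ...   | no  i≮l = x∈p∪q⁺ {p = front (before? l) C} (inj₂ (∈-comprehension⁺ (isFront? (m Fin.≤?_) C)
                            (u∈C , x , x∉C , ux , i , subst (_≤ toℕ i) (sym m≡l) (ℕ.≮⇒≥ i≮l) , u∈i , x∈i)))
  ... | inj₁ done = done
  ... | inj₂ all≤w = ℕ.≤-trans
    (front-mono always (λ i → toℕ i <? len D) λ i _ _ _ _ _ _ → Fin.toℕ<n i)
    (ℕ.≤-trans all≤w (ℕ.m≤m+n w w))

  -- Adding a vertex to a balanced set

  After Before : V → Level → Set
  After  v m = ∀ i → v ∈ X i → m <ᶠ i
  Before v m = ∀ i → v ∈ X i → i <ᶠ m

  -- By interpolation the levels of `v` form an interval, so if it misses `m` it lies on one side of
  -- `m`.
  after-or-before : ∀ v m → v ∉ X m → After v m ⊎ Before v m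
  after-or-before v m v∉m with covers-vertices D v
  ... | i , v∈i with Fin.<-cmp i m
  ...   | tri≈ _ refl _ = contradiction v∈i v∉m
  ...   | tri< i<m _ _ = inj₂ λ j v∈j → ℕ.≰⇒> λ m≤j → v∉m (interpolation D v i m j (ℕ.<⇒≤ i<m) m≤j v∈i v∈j)
  ...   | tri> _ _ m<i = inj₁ λ j v∈j → ℕ.≰⇒> λ j≤m → v∉m (interpolation D v j m i j≤m (ℕ.<⇒≤ m<i) v∈j v∈i)

  -- Adding a vertex after (before) m may destroy the balance at m only if m is
  -- right-tight (left-tight).
  RightTight LeftTight : Subset (n G) → Level → Set
  RightTight C m = inner C m ≤ right C m × inner C m < left C m
  LeftTight  C m = inner C m ≤ left C m × inner C m < right C m

  rightTight? : ∀ C → Decidable (RightTight C)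
  rightTight? C m = (inner C m ≤? right C m) ×-dec (inner C m <? left C m)

  leftTight? : ∀ C → Decidable (LeftTight C)
  leftTight? C m = (inner C m ≤? left C m) ×-dec (inner C m <? right C m)

  Admissible : Subset (n G) → V → Set
  Admissible C v = (∀ m → RightTight C m → ¬ After v m) × (∀ m → LeftTight C m → ¬ Before v m)

  inner-mono : ∀ C v m → inner C m ≤ inner (C ∪ ⁅ v ⁆) m
  inner-mono C v m = p⊆q⇒∣p∣≤∣q∣ λ x∈ →
    let x∈C , x∈m = x∈p∩q⁻ C (X m) x∈ in x∈p∩q⁺ (p⊆p∪⁅x⁆ C v x∈C , x∈m)

  inner-< : ∀ {C v m} → v ∉ C → v ∈ X m → inner C m < inner (C ∪ ⁅ v ⁆) m
  inner-< {C} {v} {m} v∉C v∈m = p⊂q⇒∣p∣<∣q∣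
    ( (λ x∈ → let x∈C , x∈m = x∈p∩q⁻ C (X m) x∈ in x∈p∩q⁺ (p⊆p∪⁅x⁆ C v x∈C , x∈m))
    , v , x∈p∩q⁺ (x∈p∪⁅x⁆ C v , v∈m) , v∉C ∘ proj₁ ∘ x∈p∩q⁻ C (X m))

  -- If `v` lies in `X m`, the smaller side grows by at most one and `inner` by at least one. If `v`
  -- is after `m`, `left` cannot grow, which settles the case `left ≤ inner`. Otherwise `m` is not
  -- right-tight by admissibility, so `right < inner` and there is room for one more vertex. The
  -- case before `m` is symmetric.
  admissible⇒balanced : ∀ {C v} → Balanced C → v ∉ C → Admissible C v → Balanced (C ∪ ⁅ v ⁆)
  admissible⇒balanced {C} {v} bal v∉C (¬after , ¬before) m with v ∈? X m
  ... | yes v∈m with bal m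
  ...   | inj₁ l≤ = inj₁ (ℕ.≤-trans (front-∪⁅⁆ (Fin._≤? m) C v) (ℕ.≤-trans (s≤s l≤) (inner-< v∉C v∈m)))
  ...   | inj₂ r≤ = inj₂ (ℕ.≤-trans (front-∪⁅⁆ (m Fin.≤?_) C v) (ℕ.≤-trans (s≤s r≤) (inner-< v∉C v∈m)))
  admissible⇒balanced {C} {v} bal v∉C (¬after , ¬before) m | no v∉m with after-or-before v m v∉m
  ... | inj₁ after with left C m ≤? inner C m | bal m
  ...   | yes l≤ | _ = inj₁ (ℕ.≤-trans (front-∪⁅⁆-avoiding (Fin._≤? m) C v (λ i v∈i → ℕ.<⇒≱ (after i v∈i)))
                         (ℕ.≤-trans l≤ (inner-mono C v m)))
  ...   | no l≰ | inj₁ l≤ = contradiction l≤ l≰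
  ...   | no l≰ | inj₂ _ = inj₂ (ℕ.≤-trans (front-∪⁅⁆ (m Fin.≤?_) C v)
                             (ℕ.≤-trans (ℕ.≰⇒> λ c≤r → ¬after m (c≤r , ℕ.≰⇒> l≰) after) (inner-mono C v m)))
  admissible⇒balanced {C} {v} bal v∉C (¬after , ¬before) m | no v∉m | inj₂ before with right C m ≤? inner C m | bal m
  ...   | yes r≤ | _ = inj₂ (ℕ.≤-trans (front-∪⁅⁆-avoiding (m Fin.≤?_) C v (λ i v∈i → ℕ.<⇒≱ (before i v∈i)))
                         (ℕ.≤-trans r≤ (inner-mono C v m)))
  ...   | no r≰ | inj₂ r≤ = contradiction r≤ r≰
  ...   | no r≰ | inj₁ _ = inj₁ (ℕ.≤-trans (front-∪⁅⁆ (Fin._≤? m) C v)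
                             (ℕ.≤-trans (ℕ.≰⇒> λ c≤l → ¬before m (c≤l , ℕ.≰⇒> r≰) before) (inner-mono C v m)))

  after? : ∀ v → Decidable (After v)
  after? v m with Fin.any? (λ i → v ∈? X i ×-dec i Fin.≤? m)
  ... | yes (i , v∈i , i≤m) = no λ after → ℕ.<⇒≱ (after i v∈i) i≤m
  ... | no none = yes λ i v∈i → ℕ.≰⇒> λ i≤m → none (i , v∈i , i≤m)

  before? : ∀ v → Decidable (Before v)
  before? v m with Fin.any? (λ i → v ∈? X i ×-dec m Fin.≤? i)
  ... | yes (i , v∈i , m≤i) = no λ before → ℕ.<⇒≱ (before i v∈i) m≤i
  ... | no none = yes λ i v∈i → ℕ.≰⇒> λ m≤i → none (i , v∈i , m≤i)

  rightTight⇒right<left : ∀ {C m} → Balanced C → RightTight C m → right C m < left C m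
  rightTight⇒right<left {C} {m} bal (_ , c<l) with bal m
  ... | inj₁ l≤c = contradiction l≤c (ℕ.<⇒≱ c<l)
  ... | inj₂ r≤c = ℕ.≤-<-trans r≤c c<l

  leftTight⇒left<right : ∀ {C m} → Balanced C → LeftTight C m → left C m < right C m
  leftTight⇒left<right {C} {m} bal (_ , c<r) with bal m
  ... | inj₁ l≤c = ℕ.≤-<-trans l≤c c<r
  ... | inj₂ r≤c = contradiction r≤c (ℕ.<⇒≱ c<r)

  Exit : Subset (n G) → V → Set
  Exit C v = v ∉ C × ∃[ u ] (u ∈ C × Adj G u v)

  exit? : ∀ C → Decidable (Exit C)
  exit? C v = ¬? (v ∈? C) ×-dec Fin.any? λ u → u ∈? C ×-dec (adj G u v Bool.≟ true)

  -- Let p be the least right-tight and q the greatest left-tight level.  If each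
  -- exit were after p or before q, then
  -- left p ≤ left q < right q ≤ right p < left p.
  admissible-exit : ∀ {C} → Balanced C → ∃ (Exit C) → ∃[ v ] (Exit C v × Admissible C v)
  admissible-exit {C} bal (v₀ , exit₀) with least (rightTight? C) | greatest (leftTight? C)
  ... | inj₁ noR | inj₁ noL = v₀ , exit₀ , (λ m t _ → noR m t) , (λ m t _ → noL m t)
  ... | inj₂ (p , tight , p≤) | inj₁ noL with Fin.any? (λ v → exit? C v ×-dec ¬? (after? v p))
  -- Testing `p` suffices: `p` is least, so a vertex after any right-tight `m` would also be after
  -- `p`.
  ...   | yes (v , exit , ¬after) =
          v , exit , (λ m t after → ¬after λ i v∈i → ℕ.≤-<-trans (p≤ m t) (after i v∈i)) , (λ m t _ → noL m t)
  -- All exits are after `p`, so no edge leaving `C` lies in a bag up to `p`. Then `left C p` is 0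
  -- and cannot exceed `right C p`.
  ...   | no none = contradiction (rightTight⇒right<left bal tight)
          (subst (λ l → ¬ (right C p < l)) (sym left≡0) λ ())
    where
    left≡0 : left C p ≡ 0
    left≡0 = front-empty (Fin._≤? p) λ {u} {v} i v∉C uv u∈C u∈i v∈i i≤p →
      none (v , (v∉C , u , u∈C , uv) , λ after → ℕ.<⇒≱ (after i v∈i) i≤p)
  admissible-exit {C} bal (v₀ , exit₀) | inj₁ noR | inj₂ (q , tight , ≤q) with Fin.any? (λ v → exit? C v ×-dec ¬? (before? v q))
  ...   | yes (v , exit , ¬before) =
          v , exit , (λ m t _ → noR m t) , (λ m t before → ¬before λ i v∈i → ℕ.<-≤-trans (before i v∈i) (≤q m t))
  ...   | no none = contradiction (leftTight⇒left<right bal tight)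
          (subst (λ r → ¬ (left C q < r)) (sym right≡0) λ ())
    where
    right≡0 : right C q ≡ 0
    right≡0 = front-empty (q Fin.≤?_) λ {u} {v} i v∉C uv u∈C u∈i v∈i q≤i →
      none (v , (v∉C , u , u∈C , uv) , λ before → ℕ.<⇒≱ (before i v∈i) q≤i)
  admissible-exit {C} bal (v₀ , exit₀) | inj₂ (p , tightp , p≤) | inj₂ (q , tightq , ≤q)
    with Fin.any? (λ v → exit? C v ×-dec ¬? (after? v p) ×-dec ¬? (before? v q))
  ...   | yes (v , exit , ¬after , ¬before) =
          v , exit , (λ m t after → ¬after λ i v∈i → ℕ.≤-<-trans (p≤ m t) (after i v∈i))
                   , (λ m t before → ¬before λ i v∈i → ℕ.<-≤-trans (before i v∈i) (≤q m t))
  ...   | no none = ⊥-elim (ℕ.<-irrefl refl (begin-strict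
            -- An edge counted on the left has its outer end in a bag at a level `i ≤ p`. That exit
            -- is not after `p`, hence is before `q`, which gives `i < q`. The comparison of the
            -- right counts is the mirror image.
            left C p  ≤⟨ front-mono (Fin._≤? p) (Fin._≤? q) (λ {u} {v} i v∉C uv u∈C u∈i v∈i i≤p →
                           ℕ.<⇒≤ (before-q (v∉C , u , u∈C , uv) (λ after → ℕ.<⇒≱ (after i v∈i) i≤p) i v∈i)) ⟩
            left C q  <⟨ leftTight⇒left<right bal tightq ⟩
            right C q ≤⟨ front-mono (q Fin.≤?_) (p Fin.≤?_) (λ {u} {v} i v∉C uv u∈C u∈i v∈i q≤i →
                           ℕ.<⇒≤ (after-p (v∉C , u , u∈C , uv) (λ before → ℕ.<⇒≱ (before i v∈i) q≤i) i v∈i)) ⟩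
            right C p <⟨ rightTight⇒right<left bal tightp ⟩
            left C p  ∎))
    where
    open ℕ.≤-Reasoning

    before-q : ∀ {v} → Exit C v → ¬ After v p → Before v q
    before-q {v} exit ¬after = decidable-stable (before? v q) λ ¬before → none (v , exit , ¬after , ¬before)

    after-p : ∀ {v} → Exit C v → ¬ Before v q → After v p
    after-p {v} exit ¬before = decidable-stable (after? v p) λ ¬after → none (v , exit , ¬after , ¬before)

  -- All fronts of the empty set are empty, so it is balanced without tight levels and every vertex
  -- is admissible. The singleton is written as a union so that the lemma on adding a vertex
  -- applies.
  balanced-⁅⁆ : ∀ v → Balanced (⊥ ∪ ⁅ v ⁆)
  balanced-⁅⁆ v = admissible⇒balanced (λ m → inj₁ (ℕ.≤-trans (ℕ.≤-reflexive (no-front (Fin._≤? m))) z≤n)) ∉⊥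
    ( (λ m (_ , c<l) _ → ℕ.n≮0 (subst (inner ⊥ m <_) (no-front (Fin._≤? m)) c<l))
    , (λ m (_ , c<r) _ → ℕ.n≮0 (subst (inner ⊥ m <_) (no-front (m Fin.≤?_)) c<r)) )
    where
    no-front : {P : Pred Level 0ℓ} (P? : Decidable P) → ∣ front P? ⊥ ∣ ≡ 0
    no-front P? = front-empty P? λ _ _ _ u∈⊥ → ⊥-elim (∉⊥ u∈⊥)

-- Lion strategies

module Lions (G : Graph) {k : ℕ} where

  private
    V : Set
    V = Fin (n G)

  record State : Set where
    constructor _,_
    field
      lion  : Fin k → V
      clean : Subset (n G)

  open State

  -- These conditions make `clean` the exact complement of the contaminated set. `grows` and
  -- `within` keep every vertex outside it contaminated. `occupied` accounts for newly clean
  -- vertices, and `guarded` puts a lion, after the move, on each clean vertex that had a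
  -- contaminated neighbour.
  record Step (s s′ : State) : Set where
    field
      legal    : ∀ i → lion s′ i ≡ lion s i ⊎ Adj G (lion s i) (lion s′ i)
      grows    : clean s ⊆ clean s′
      within   : ∀ i → lion s′ i ∈ clean s′
      occupied : ∀ {v} → v ∈ clean s′ → v ∉ clean s → ∃[ i ] lion s′ i ≡ v
      guarded  : ∀ {u v} → u ∈ clean s → v ∉ clean s → Adj G u v → ∃[ i ] lion s′ i ≡ u

  open Step

  Full : State → Set
  Full s = ∀ v → v ∈ clean s

  full⇒stay : ∀ {s} → Full s → Step s s
  full⇒stay full = record
    { legal    = λ _ → inj₁ refl
    ; grows    = id
    ; within   = λ _ → full _
    ; occupied = λ _ v∉ → contradiction (full _) v∉
    ; guarded  = λ _ v∉ → contradiction (full _) v∉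
    }

  -- A strategy needs positions at all times, so the final state is repeated forever. When it is
  -- full, `full⇒stay` makes each repetition a `Step`.
  run : ∀ {s s′} → Star Step s s′ → ℕ → State
  run {s} ε        _       = s
  run {s} (x ◅ xs) zero    = s
  run     (x ◅ xs) (suc t) = run xs t

  run-zero : ∀ {s s′} (xs : Star Step s s′) → run xs 0 ≡ s
  run-zero ε       = refl
  run-zero (_ ◅ _) = refl

  run-step : ∀ {s s′} (xs : Star Step s s′) → Full s′ → ∀ t → Step (run xs t) (run xs (suc t))
  run-step ε        full t       = full⇒stay full
  run-step (x ◅ xs) full zero    = subst (Step _) (sym (run-zero xs)) x
  run-step (x ◅ xs) full (suc t) = run-step xs full t

  run-full : ∀ {s s′} (xs : Star Step s s′) → Full s′ → ∃[ T ] Full (run xs T)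
  run-full ε        full = 0 , full
  run-full (x ◅ xs) full = let T , fullT = run-full xs full in suc T , fullT

  -- By induction on time, `W` is the complement of `clean`, in both directions. Growth of `clean`
  -- then gives monotonicity, and a full state gives clearing.
  star⇒monotoneClearable : ∀ {s s′} → Star Step s s′ → Full s′ →
    (∀ i → lion s i ∈ clean s) → (∀ {v} → v ∈ clean s → ∃[ i ] lion s i ≡ v) → MonotoneClearable G k
  star⇒monotoneClearable {s} xs full within₀ occupied₀ = strategy , monotone , T , λ v → W⇒∉ T (fullT v)
    where
    at : ℕ → State
    at = run xs

    st : ∀ t → Step (at t) (at (suc t))
    st = run-step xs full

    T = proj₁ (run-full xs full)
    fullT = proj₂ (run-full xs full)

    strategy : LionStrategy G k
    strategy = record { pos = lion ∘ at ; moves = legal ∘ st }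

    ∉⇒W : ∀ t {v} → v ∉ clean (at t) → W strategy t v
    ∉⇒W zero v∉ (i , refl) = v∉ (subst (λ s → lion s i ∈ clean s) (sym (run-zero xs)) (within₀ i))
    ∉⇒W (suc t) v∉ = (λ { (i , refl) → v∉ (within (st t) i) }) , inj₁ (∉⇒W t (v∉ ∘ grows (st t)))

    W⇒∉ : ∀ t {v} → v ∈ clean (at t) → ¬ W strategy t v
    W⇒∉ zero {v} v∈ ¬L = ¬L (subst (λ s → ∃[ i ] lion s i ≡ v) (sym (run-zero xs))
                          (occupied₀ (subst (λ s → v ∈ clean s) (run-zero xs) v∈)))
    W⇒∉ (suc t) {v} v∈ (¬L , cause) with v ∈? clean (at t)
    ... | no v∉ = ¬L (occupied (st t) v∈ v∉)
    W⇒∉ (suc t) v∈ (¬L , inj₁ Wv) | yes v∈t = W⇒∉ t v∈t Wv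
    -- The contaminated neighbour `x` is outside `clean`, so `guarded` places a lion on `v` itself.
    -- This blocks recontamination whatever edges the lions traverse.
    W⇒∉ (suc t) v∈ (¬L , inj₂ (x , Wx , vx , _)) | yes v∈t =
      ¬L (guarded (st t) v∈t (λ x∈ → W⇒∉ t x∈ Wx) vx)

    monotone : Monotone strategy
    monotone t v Wv = ∉⇒W t λ v∈ → W⇒∉ (suc t) (grows (st t) v∈) Wv

  -- Moving a spare lion inside the clean set

  data WalkIn (C : Subset (n G)) : V → V → Set where
    stop : ∀ {v} → WalkIn C v v
    go   : ∀ {u x v} → Adj G u x → x ∈ C → WalkIn C x v → WalkIn C u v

  walkIn-⊆ : ∀ {C C′ u v} → C ⊆ C′ → WalkIn C u v → WalkIn C′ u v
  walkIn-⊆ C⊆C′ stop         = stop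
  walkIn-⊆ C⊆C′ (go ux x∈ p) = go ux (C⊆C′ x∈) (walkIn-⊆ C⊆C′ p)

  walkIn-∷ʳ : ∀ {C u x v} → WalkIn C u x → Adj G x v → v ∈ C → WalkIn C u v
  walkIn-∷ʳ stop         xv v∈ = go xv v∈ stop
  walkIn-∷ʳ (go ux x∈ p) xv v∈ = go ux x∈ (walkIn-∷ʳ p xv v∈)

  ConnectedIn : Subset (n G) → Set
  ConnectedIn C = ∀ {u v} → u ∈ C → v ∈ C → WalkIn C u v

  connectedIn-∪⁅⁆ : ∀ {C u v} → ConnectedIn C → u ∈ C → Adj G u v → ConnectedIn (C ∪ ⁅ v ⁆)
  connectedIn-∪⁅⁆ {C} {u} {v} conn u∈C uv x∈ y∈ with x∈p∪⁅y⁆⁻ C v x∈ | x∈p∪⁅y⁆⁻ C v y∈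
  ... | inj₁ x∈C  | inj₁ y∈C  = walkIn-⊆ (p⊆p∪⁅x⁆ C v) (conn x∈C y∈C)
  ... | inj₁ x∈C  | inj₂ refl = walkIn-∷ʳ (walkIn-⊆ (p⊆p∪⁅x⁆ C v) (conn x∈C u∈C)) uv y∈
  ... | inj₂ refl | inj₁ y∈C  = go (trans (Graph.sym G v u) uv) (p⊆p∪⁅x⁆ C v u∈C) (walkIn-⊆ (p⊆p∪⁅x⁆ C v) (conn u∈C y∈C))
  ... | inj₂ refl | inj₂ refl = stop

  -- Lion `i` is free: the guards are other lions, so the property survives any move of `i`, even
  -- when `i` leaves a boundary vertex.
  GuardedWithout : Fin k → State → Set
  GuardedWithout i (p , C) = ∀ {u v} → u ∈ C → v ∉ C → Adj G u v → ∃[ j ] (j ≢ i × p j ≡ u)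

  move : Fin k → V → (Fin k → V) → Fin k → V
  move i x p = updateAt p i (const x)

  move-legal : ∀ {i x p} → Adj G (p i) x → ∀ j → move i x p j ≡ p j ⊎ Adj G (p j) (move i x p j)
  move-legal {i} {x} {p} px j with j Fin.≟ i
  ... | yes refl = inj₂ (subst (Adj G (p i)) (sym (updateAt-updates i p)) px)
  ... | no  j≢i  = inj₁ (updateAt-minimal j i p j≢i)

  move-within : ∀ {i x p} {C C′ : Subset (n G)} → C ⊆ C′ → x ∈ C′ → (∀ j → p j ∈ C) → ∀ j → move i x p j ∈ C′
  move-within {i} {x} {p} {C′ = C′} C⊆C′ x∈ p∈ j with j Fin.≟ i
  ... | yes refl = subst (_∈ C′) (sym (updateAt-updates i p)) x∈
  ... | no  j≢i  = subst (_∈ C′) (sym (updateAt-minimal j i p j≢i)) (C⊆C′ (p∈ j))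

  move-guarded : ∀ {i p C} x → GuardedWithout i (p , C) → GuardedWithout i (move i x p , C)
  move-guarded {i} {p} x guard u∈ v∉ uv with guard u∈ v∉ uv
  ... | j , j≢i , refl = j , j≢i , updateAt-minimal j i p j≢i

  move-step : ∀ {i x p C} → (∀ j → p j ∈ C) → GuardedWithout i (p , C) → Adj G (p i) x →
    Step (p , C) (move i x p , C ∪ ⁅ x ⁆)
  move-step {i} {x} {p} {C} p∈ guard px = record
    { legal    = move-legal px
    ; grows    = p⊆p∪⁅x⁆ C x
    ; within   = move-within (p⊆p∪⁅x⁆ C x) (x∈p∪⁅x⁆ C x) p∈
    ; occupied = λ v∈ v∉ → i , trans (updateAt-updates i p) (sym ([ flip contradiction v∉ , id ]′ (x∈p∪⁅y⁆⁻ C x v∈)))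
    ; guarded  = λ u∈ v∉ uv → let j , _ , pj≡u = move-guarded x guard u∈ v∉ uv in j , pj≡u
    }

  -- Only lion `i` moves, so the other lions keep the boundary guarded and the clean set stays `C`.
  -- Every vertex entered on a `WalkIn C` lies in `C`, as `within` demands.
  walk-steps : ∀ {i p C x y} → (∀ j → p j ∈ C) → GuardedWithout i (p , C) → p i ≡ x → WalkIn C x y →
    ∃[ p′ ] (Star Step (p , C) (p′ , C) × p′ i ≡ y × (∀ j → p′ j ∈ C) × GuardedWithout i (p′ , C))
  walk-steps {i} {p} p∈ guard pi≡x stop = p , ε , pi≡x , p∈ , guard
  walk-steps {i} {p} {C} p∈ guard refl (go {x = x} px x∈ walk)
    with walk-steps {p = move i x p} (move-within id x∈ p∈) (move-guarded x guard) (updateAt-updates i p) walk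
  ... | p′ , steps , rest = p′ , step₁ ◅ steps , rest
    where
    step₁ : Step (p , C) (move i x p , C)
    step₁ = record
      { legal    = move-legal px
      ; grows    = id
      ; within   = move-within id x∈ p∈
      ; occupied = λ v∈ v∉ → contradiction v∈ v∉
      ; guarded  = λ u∈ v∉ uv → let j , _ , pj≡u = move-guarded x guard u∈ v∉ uv in j , pj≡u
      }

-- Clearing a connected graph with `2w + 1` lions

module _ (G : Graph) (D : PathDecomposition G) (w : ℕ) (width : HasWidth≤ D w) where
  open Balance G D
  open Lions G {suc (w + w)}

  exit-on-walk : ∀ {C u v} → u ∈ C → v ∉ C → Walk G u v → ∃ (Exit C)
  exit-on-walk u∈ v∉ here = contradiction u∈ v∉
  exit-on-walk {C} u∈ v∉ (step {w = x} ux walk) with x ∈? C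
  ... | yes x∈ = exit-on-walk x∈ v∉ walk
  ... | no  x∉ = x , x∉ , _ , u∈ , ux

  -- Induction on `d`, a bound on the number of vertices still outside `C`. In each round a spare
  -- lion walks to a neighbour `u` of an admissible exit `v` and then steps onto `v`.
  clearing-steps : (∀ u v → Walk G u v) → ∀ d p C → n G ≤ d + ∣ C ∣ →
    Balanced C → ConnectedIn C → (∀ i → p i ∈ C) →
    (∀ {u v} → u ∈ C → v ∉ C → Adj G u v → ∃[ i ] p i ≡ u) →
    ∃[ s ] (Star Step (p , C) s × Full s)
  clearing-steps walks d p C n≤ bal conn p∈ guard with Fin.all? (_∈? C)
  ... | yes full = (p , C) , ε , full
  ... | no ¬full with Fin.¬∀⟶∃¬ (n G) (_∈ C) (_∈? C) ¬full
  -- The position of any lion shows that `C` is nonempty, and a walk from there to `z` must leave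
  -- `C`.
  ... | z , z∉ with admissible-exit bal (exit-on-walk (p∈ zero) z∉ (walks (p zero) z))
  ... | v , (v∉ , u , u∈ , uv) , adm
      with spare p (∂ C)
             (λ x∈∂ → let x∈ , y , y∉ , xy , _ = ∈-comprehension⁻ (isFront? always C) x∈∂ in guard x∈ y∉ xy)
             (s≤s (balanced⇒∣∂∣≤2w width bal))
  ... | i , guard-i with walk-steps {i} p∈ (λ x∈ y∉ xy → guard-i (∈∂⁺ x∈ y∉ xy)) refl (conn (p∈ i) u∈)
  -- With `d` equal to 0, `C` would have at least `n G` vertices, although `v` is outside it.
  ... | p′ , steps , refl , p′∈ , guard′ with d
  ... | zero = contradiction (ℕ.<-≤-trans (x∉p⇒∣p∣<∣p∪⁅x⁆∣ C v∉) (∣p∣≤n (C ∪ ⁅ v ⁆))) (ℕ.≤⇒≯ n≤)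
  ... | suc d′ with clearing-steps walks d′ (move i v p′) (C ∪ ⁅ v ⁆)
                      (ℕ.≤-trans n≤ (ℕ.≤-trans (ℕ.≤-reflexive (sym (ℕ.+-suc d′ ∣ C ∣)))
                        (ℕ.+-monoʳ-≤ d′ (x∉p⇒∣p∣<∣p∪⁅x⁆∣ C v∉))))
                      (admissible⇒balanced bal v∉ adm) (connectedIn-∪⁅⁆ conn u∈ uv)
                      (move-within {i} (p⊆p∪⁅x⁆ C v) (x∈p∪⁅x⁆ C v) p′∈)
                      new-guard
    where
    -- Lion `i` now stands on `v` and guards it. A boundary vertex inherited from `C` was already on
    -- the old boundary, where a lion other than `i` stands.
    new-guard : ∀ {x y} → x ∈ C ∪ ⁅ v ⁆ → y ∉ C ∪ ⁅ v ⁆ → Adj G x y → ∃[ j ] move i v p′ j ≡ x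
    new-guard x∈ y∉ xy with x∈p∪⁅y⁆⁻ C v x∈
    ... | inj₂ refl = i , updateAt-updates i p′
    ... | inj₁ x∈C  = let j , _ , eq = move-guarded v guard′ x∈C (y∉ ∘ p⊆p∪⁅x⁆ C v) xy in j , eq
  ... | s , rest , full = s , steps ◅◅ (move-step p′∈ guard′ uv ◅ rest) , full

  monotoneClearable : Connected G → MonotoneClearable G (suc (w + w))
  monotoneClearable (0<n , walks) = star⇒monotoneClearable steps full (λ _ → start∈) occupied
    where
    start : Fin (n G)
    start = fromℕ< 0<n

    C₀ : Subset (n G)
    C₀ = ⊥ ∪ ⁅ start ⁆

    start∈ : start ∈ C₀
    start∈ = x∈p∪⁅x⁆ ⊥ start

    unique : ∀ {x} → x ∈ C₀ → start ≡ x
    unique x∈ = sym ([ ⊥-elim ∘ ∉⊥ , id ]′ (x∈p∪⁅y⁆⁻ ⊥ start x∈))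

    occupied : ∀ {v} → v ∈ C₀ → ∃[ i ] start ≡ v
    occupied v∈ = zero {w + w} , unique v∈

    connected : ConnectedIn C₀
    connected x∈ y∈ with unique x∈ | unique y∈
    ... | refl | refl = stop

    cleared : ∃[ s ] (Star Step (const start , C₀) s × Full s)
    cleared = clearing-steps walks (n G) (const start) C₀ (ℕ.m≤m+n (n G) ∣ C₀ ∣) (balanced-⁅⁆ start) connected
      (λ _ → start∈) (λ u∈ _ _ → occupied u∈)

    steps = proj₁ (proj₂ cleared)
    full  = proj₂ (proj₂ cleared)

theorem22 : (G : Graph) → Connected G → (w : ℕ) → Pathwidth G w →
    ∃[ k ] (1 ≤ k × k ≤ 2 * w + 2 × MonotoneClearable G k)
theorem22 G conn w ((D , width) , _) = suc (w + w) , s≤s z≤n , bound , monotoneClearable G D w width conn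
  where
  open ℕ.≤-Reasoning

  bound : suc (w + w) ≤ 2 * w + 2
  -- The construction uses one lion fewer than the bound allows.
  bound = begin
    suc (w + w)       ≡⟨ cong (λ x → suc (w + x)) (sym (ℕ.+-identityʳ w)) ⟩
    suc (2 * w)       ≤⟨ ℕ.n≤1+n _ ⟩
    2 + 2 * w         ≡⟨ ℕ.+-comm 2 (2 * w) ⟩
    2 * w + 2         ∎
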